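{- Let $n \ge 4$ be an integer. In the Maker-Breaker Hamiltonian Path game $\mathcal{HP}_n$ on $E(K_n)$, Maker as first player has a winning strategy if and only if $n \geq 5$; and likewise Maker as second player has a winning strategy if and only if $n \geq 5$.
   Context: A positional game is a hypergraph $(X,\mathcal{F})$, where $X$ is a finite set (the board) and $\mathcal{F}\subseteq 2^X$ is a family of winning sets. In the Maker-Breaker game on $(X,\mathcal{F})$, two players, Maker and Breaker, alternately claim previously unclaimed elements of $X$, one element per move, until all elements are claimed. Maker wins if he claims all elements of some winning set; Breaker wins if he claims at least one element of every winning set. "Maker as first player" means that Maker makes the first move; "Maker as second player" means that Breaker makes the first move. A player "wins" the game if he has a winning strategy, i.e. a strategy that guarantees his win against every play of the opponent. In the Hamiltonian Path game $\mathcal{HP}_n$, the board is $X = E(K_n)$, the edge set of the complete graph on $n$ vertices, and the winning sets are the edge sets of all Hamiltonian paths of $K_n$ (with arbitrary endpoints). -}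

module Defs where

open import Data.Fin.Base using (Fin; _<_)
open import Data.Fin.Properties using (_≟_; _<?_)
open import Data.List.Base using (List; []; _∷_; concatMap; cartesianProduct; allFin)
open import Data.List.Membership.Propositional using (_∈_; _∉_; lose)
open import Data.List.Membership.Propositional.Properties
  using (∈-allFin; ∈-cartesianProduct⁺; ∈-concatMap⁺)
open import Data.List.Relation.Unary.Any using (here)
open import Data.List.Relation.Unary.Unique.Propositional using (Unique)
open import Data.Nat.Base using (ℕ)
open import Data.Product.Base using (_×_; _,_; ∃-syntax; proj₁)
open import Data.Sum.Base using (_⊎_)
open import Level using (0ℓ)
open import Relation.Binary.Definitions using (DecidableEquality)
open import Relation.Binary.PropositionalEquality using (_≡_; refl)
open import Relation.Nullary.Decidable.Core using (Dec; yes; no)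
open import Relation.Nullary.Negation.Core using (contradiction-irr)
open import Relation.Unary using (Pred; _⊆_; _≐_)

------------------------------------------------------------------------
-- Positional games

record PositionalGame : Set₁ where
  field
    X          : Set
    _≟ₓ_       : DecidableEquality X
    elements   : List X
    enumerates : ∀ x → x ∈ elements
    𝓕          : Pred (Pred X 0ℓ) 0ℓ

data Player : Set where
  maker breaker : Player

opponent : Player → Player
opponent maker   = breaker
opponent breaker = maker

-- A history is the list of all moves made so far by both players, the most
-- recent move first.

module MakerBreaker (G : PositionalGame) (first : Player) where
  open PositionalGame G

  History : Set
  History = List X

  toMove : History → Player
  toMove []      = first
  toMove (_ ∷ h) = opponent (toMove h)

  data Claimed (p : Player) : History → Pred X 0ℓ where
    now     : ∀ {h x} → toMove h ≡ p → Claimed p (x ∷ h) x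
    earlier : ∀ {h x y} → Claimed p h x → Claimed p (y ∷ h) x

  Free : History → Pred X 0ℓ
  Free h x = x ∉ h

  Complete : History → Set
  Complete h = ∀ x → x ∈ h

  Won : Player → History → Set₁
  Won maker   h = ∃[ F ] (𝓕 F × F ⊆ Claimed maker h)
  Won breaker h = ∀ F → 𝓕 F → ∃[ x ] (F x × Claimed breaker h x)

  -- A strategy answers every history that leaves some element unclaimed;
  -- its values at histories where it is not the player's turn are never
  -- used.  The argument witnessing a free element is irrelevant, so the
  -- answer depends on the history alone.
  Strategy : Set
  Strategy = ∀ h → .(∃[ x ] Free h x) → ∃[ x ] Free h x

  -- The histories that can arise when p follows σ and the opponent makes
  -- arbitrary legal moves.
  data Reachable (p : Player) (σ : Strategy) : History → Set where
    start  : Reachable p σ []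
    own    : ∀ {h x} → Reachable p σ h → toMove h ≡ p →
             (free : ∃[ y ] Free h y) → x ≡ proj₁ (σ h free) →
             Reachable p σ (x ∷ h)
    theirs : ∀ {h x} → Reachable p σ h → toMove h ≡ opponent p →
             Free h x → Reachable p σ (x ∷ h)

  Winning : Player → Strategy → Set₁
  Winning p σ = ∀ h → Reachable p σ h → Complete h → Won p h

  HasWinningStrategy : Player → Set₁
  HasWinningStrategy p = ∃[ σ ] Winning p σ

MakerWinsAsFirstPlayer : PositionalGame → Set₁
MakerWinsAsFirstPlayer G = MakerBreaker.HasWinningStrategy G maker maker

MakerWinsAsSecondPlayer : PositionalGame → Set₁
MakerWinsAsSecondPlayer G = MakerBreaker.HasWinningStrategy G breaker maker

------------------------------------------------------------------------
-- The edges of the complete graph on the vertex set Fin n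

-- An unordered pair of distinct vertices is stored in increasing order.
record Edge (n : ℕ) : Set where
  constructor edge
  field
    lo hi  : Fin n
    .lo<hi : lo < hi

open Edge public using (lo; hi)

infix 4 _≟ᴱ_

_≟ᴱ_ : ∀ {n} → DecidableEquality (Edge n)
edge i j _ ≟ᴱ edge k l _ with i ≟ k | j ≟ l
... | yes refl | yes refl = yes refl
... | yes _    | no j≢l   = no λ { refl → j≢l refl }
... | no i≢k   | _        = no λ { refl → i≢k refl }

edgeFrom : ∀ {n} {i j : Fin n} → Dec (i < j) → List (Edge n)
edgeFrom {i = i} {j} (yes i<j) = edge i j i<j ∷ []
edgeFrom             (no _)    = []

edges : ∀ n → List (Edge n)
edges n = concatMap (λ (i , j) → edgeFrom (i <? j))
                    (cartesianProduct (allFin n) (allFin n))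

∈-edgeFrom : ∀ {n} (e : Edge n) (d : Dec (lo e < hi e)) → e ∈ edgeFrom d
∈-edgeFrom (edge _ _ _)   (yes _)   = here refl
∈-edgeFrom (edge _ _ i<j) (no i≮j) = contradiction-irr i<j i≮j

∈-edges : ∀ {n} (e : Edge n) → e ∈ edges n
∈-edges e = ∈-concatMap⁺ (λ (i , j) → edgeFrom (i <? j))
  (lose (∈-cartesianProduct⁺ (∈-allFin (lo e)) (∈-allFin (hi e)))
        (∈-edgeFrom e (lo e <? hi e)))

------------------------------------------------------------------------
-- Hamiltonian paths of the complete graph

-- Distinct vertices are always adjacent in a complete graph, so any
-- repetition-free sequence of vertices is a path.
record HamiltonianPath (n : ℕ) : Set where
  field
    vertices : List (Fin n)
    simple   : Unique vertices
    spanning : ∀ v → v ∈ vertices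

Joins : ∀ {n} → Edge n → Fin n → Fin n → Set
Joins e u v = (lo e ≡ u × hi e ≡ v) ⊎ (lo e ≡ v × hi e ≡ u)

data OnPath {n : ℕ} : List (Fin n) → Pred (Edge n) 0ℓ where
  here  : ∀ {u v vs e} → Joins e u v → OnPath (u ∷ v ∷ vs) e
  there : ∀ {u vs e} → OnPath vs e → OnPath (u ∷ vs) e

edgeSet : ∀ {n} → HamiltonianPath n → Pred (Edge n) 0ℓ
edgeSet P = OnPath (HamiltonianPath.vertices P)

HP : ℕ → PositionalGame
HP n = record
  { X          = Edge n
  ; _≟ₓ_       = _≟ᴱ_
  ; elements   = edges n
  ; enumerates = ∈-edges
  ; 𝓕          = λ F → ∃[ P ] (F ≐ edgeSet {n} P)
  }

{-# OPTIONS --safe #-}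

-- Breaker's first edge can be taken to be ab, and Maker answers bc.  From
-- seven vertices on, Maker then plays the game without b and c, in which
-- Breaker moves first again, and pairs the edges ub and uc for every remaining
-- vertex u other than a.  One end of the path he obtains differs from a, hence
-- is joined to b or to c, and the path extends through the edge bc.  On five
-- and six vertices the greedy strategy, which claims an edge lying in as many
-- surviving paths as possible, succeeds by exhaustive evaluation.  On four
-- vertices, every Hamiltonian path contains a perfect matching, so Breaker
-- wins by pairing the edges of each of the three perfect matchings.
module Submission where

open import Defs
open import Data.Bool.Base using (Bool; true; false; if_then_else_; not; _∧_; _∨_; T)
open import Data.Bool.ListAction using (any; all)
open import Data.Bool.Properties using (T-∨; T?)
open import Data.Fin.Base using (Fin; zero; suc)
open import Data.Fin.Properties as Finₚ using (all?)
open import Data.List.Base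
  using (List; []; _∷_; [_]; _++_; _∷ʳ_; map; length; null; filter; filterᵇ; concat; concatMap;
         upTo; applyUpTo; allFin; initLast; _∷ʳ′_)
import Data.List.Membership.DecPropositional as DecMembership
open import Data.List.Membership.Propositional using (_∈_; _∉_; find; lose)
open import Data.List.Membership.Propositional.Properties
  using (∈-map⁺; ∈-map⁻; ∈-++⁺ˡ; ∈-++⁺ʳ; ∈-++⁻; ∈-filter⁺; ∈-filter⁻; ∈-∃++; ∈-upTo⁻; ∈-allFin)
open import Data.List.Membership.Propositional.Properties.WithK using (unique∧set⇒bag)
open import Data.List.Properties
  using (++-assoc; concat-map-[_]; filter-notAll; length-tabulate; map-upTo)
open import Data.List.Relation.Binary.BagAndSetEquality using (∼bag⇒↭)
open import Data.List.Relation.Binary.Disjoint.Propositional using (Disjoint)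
open import Data.List.Relation.Binary.Permutation.Propositional
  using (_↭_; refl; prep; swap; ↭-sym; ↭-trans; ↭⇒↭ₛ)
open import Data.List.Relation.Binary.Permutation.Propositional.Properties as Perm
  using (shift; shifts; ∈-resp-↭; ↭-length; drop-∷; ++-comm)
import Data.List.Relation.Binary.Permutation.Setoid.Properties as PermSetoid
open import Data.List.Relation.Binary.Subset.Propositional using (_⊆_)
open import Data.List.Relation.Binary.Subset.Propositional.Properties as Subset using (⊆-refl)
open import Data.List.Relation.Unary.All as All using (All; []; _∷_)
import Data.List.Relation.Unary.All.Properties as Allₚ
open import Data.List.Relation.Unary.AllPairs using ([]; _∷_)
open import Data.List.Relation.Unary.Any as Any using (Any; here; there; any?)
import Data.List.Relation.Unary.Any.Properties as Anyₚ
open import Data.List.Relation.Unary.Linked as Linked using (Linked; []; [-]; _∷_)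
import Data.List.Relation.Unary.Linked.Properties as Linkedₚ
import Data.List.Relation.Unary.Unique.DecPropositional as DecUnique
open import Data.List.Relation.Unary.Unique.Propositional using (Unique)
open import Data.List.Relation.Unary.Unique.Propositional.Properties using (upTo⁺; allFin⁺)
open import Data.Nat.Base
  using (ℕ; zero; suc; _+_; _*_; _/_; _%_; _⊓_; _⊔_; _≤_; _<_; _≥_; _<ᵇ_; _≡ᵇ_;
         z≤n; s≤s; z<s; s<s⁻¹; s≤s⁻¹)
open import Data.Nat.Divisibility using (n∣m*n)
open import Data.Nat.DivMod
  using (m<n⇒m/n≡0; m<n⇒m%n≡m; [m+kn]%n≡m%n; +-distrib-/-∣ʳ; m*n/n≡m)
open import Data.Nat.Properties
  using (≡ᵇ⇒≡; ≡⇒≡ᵇ; _≟_; ⊓-comm; ⊔-comm; ⊔-lub; ≤-refl; ≤-trans; ≤-total;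
         m≤n⇒m⊓n≡m; m≤n⇒m⊔n≡n; m≥n⇒m⊓n≡n; m≥n⇒m⊔n≡m; m≤m+n; suc-injective)
open import Data.Product.Base using (_×_; _,_; proj₁; proj₂; ∃-syntax)
open import Data.Sum.Base as Sum using (_⊎_; inj₁; inj₂; [_,_]′)
open import Function.Base using (_∘_; id; _|>_)
open import Function.Bundles using (_⇔_; mk⇔; Equivalence)
open import Relation.Binary.Definitions using (tri<; tri≈; tri>)
open import Relation.Binary.PropositionalEquality
  using (_≡_; _≢_; refl; sym; trans; cong; cong₂; subst; setoid)
open import Relation.Nullary
  using (Dec; yes; no; ¬_; ¬?; contradiction; decidable-stable; from-yes;
         _×-dec_; _⊎-dec_; _→-dec_)
open import Relation.Nullary.Negation.Core using (contradiction-irr)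

-- Strategies for a player who moves second

-- Having secured the elements m, a player who moves second can bring about G
-- as long as the opponent owns nothing in S.  Moves outside S need no answer,
-- and elements of S may already belong to the player, so that superfluous
-- moves of the player need no bookkeeping.
data Win {X : Set} (G : List X → Set) : List X → List X → Set
data Answer {X : Set} (G : List X → Set) (S : List X) (x : X) (m : List X) : Set

data Win G where
  done : ∀ {m} → G m → Win G [] m
  step : ∀ {S m x₀} → x₀ ∈ S → (∀ {x} → x ∈ S → Answer G S x m) → Win G S m

data Answer G S x m where
  answer : ∀ {S′ y} → S′ ⊆ S → x ∉ S′ → y ∈ S → y ≢ x →
           Win G S′ (y ∷ m) → Answer G S x m

-- A strategy may stop before every element of `R` has been used, so its region is only required to
-- lie in `R`.
Wins : {X : Set} (G : List X → Set) → List X → List X → Set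
Wins G R m = ∃[ S ] (S ⊆ R × Win G S m)

module _ {X Y : Set} (f : X → Y) {G : List X → Set} {G′ : List Y → Set}
         (G⇒G′ : ∀ {m} → G m → G′ (map f m)) where

  InjectiveOn : List X → Set
  InjectiveOn S = ∀ {x y} → x ∈ S → y ∈ S → f x ≡ f y → x ≡ y

  Win-map : ∀ {S m} → InjectiveOn S → Win G S m → Win G′ (map f S) (map f m)
  Answer-map : ∀ {S x m} → InjectiveOn S → x ∈ S →
               Answer G S x m → Answer G′ (map f S) (f x) (map f m)
  Win-map inj (done g) = done (G⇒G′ g)
  Win-map inj (step x₀∈S r) = step (∈-map⁺ f x₀∈S) λ fx∈ → go (∈-map⁻ f fx∈)
    where
    go : ∀ {y} → ∃[ x ] (x ∈ _ × y ≡ f x) → Answer G′ _ y _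
    go (x , x∈S , refl) = Answer-map inj x∈S (r x∈S)
  Answer-map inj x∈S (answer S′⊆S x∉S′ y∈S y≢x w) =
    answer (Subset.map⁺ f S′⊆S)
      (λ fx∈ → let z , z∈S′ , fx≡fz = ∈-map⁻ f fx∈ in
        x∉S′ (subst (_∈ _) (sym (inj x∈S (S′⊆S z∈S′) fx≡fz)) z∈S′))
      (∈-map⁺ f y∈S) (y≢x ∘ inj y∈S x∈S)
      (Win-map (λ x∈ y∈ → inj (S′⊆S x∈) (S′⊆S y∈)) w)

module _ {X : Set} {G₁ G₂ G : List X → Set}
         (both : ∀ {m₁ m₂ m} → m₁ ⊆ m → m₂ ⊆ m → G₁ m₁ → G₂ m₂ → G m) where

  -- Strategies on disjoint regions can be played side by side: each move is answered in the region
  -- in which it was made, and the other region is left untouched.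
  Win-++ : ∀ {S₁ S₂ m₁ m₂ m} → Disjoint S₁ S₂ → m₁ ⊆ m → m₂ ⊆ m →
           Win G₁ S₁ m₁ → Win G₂ S₂ m₂ → Win G (S₁ ++ S₂) m
  Answer-++ˡ : ∀ {S₁ S₂ x m₁ m₂ m} → Disjoint S₁ S₂ → m₁ ⊆ m → m₂ ⊆ m →
               x ∈ S₁ → Answer G₁ S₁ x m₁ → Win G₂ S₂ m₂ →
               Answer G (S₁ ++ S₂) x m
  Answer-++ʳ : ∀ {S₁ S₂ x m₁ m₂ m} → Disjoint S₁ S₂ → m₁ ⊆ m → m₂ ⊆ m →
               x ∈ S₂ → Win G₁ S₁ m₁ → Answer G₂ S₂ x m₂ →
               Answer G (S₁ ++ S₂) x m

  Win-++ _ m₁⊆m m₂⊆m (done g₁) (done g₂) = done (both m₁⊆m m₂⊆m g₁ g₂)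
  Win-++ disj m₁⊆m m₂⊆m w₁@(done _) (step x₀∈S₂ r₂) =
    step x₀∈S₂ λ x∈S₂ → Answer-++ʳ disj m₁⊆m m₂⊆m x∈S₂ w₁ (r₂ x∈S₂)
  Win-++ {S₁} disj m₁⊆m m₂⊆m (step x₀∈S₁ r₁) w₂@(done _) =
    step (∈-++⁺ˡ x₀∈S₁) λ x∈ → [ (λ x∈S₁ → Answer-++ˡ disj m₁⊆m m₂⊆m x∈S₁ (r₁ x∈S₁) w₂)
                               , (λ ()) ]′ (∈-++⁻ S₁ x∈)
  Win-++ {S₁} disj m₁⊆m m₂⊆m w₁@(step x₀∈S₁ r₁) w₂@(step _ r₂) =
    step (∈-++⁺ˡ x₀∈S₁) λ x∈ → [ (λ x∈S₁ → Answer-++ˡ disj m₁⊆m m₂⊆m x∈S₁ (r₁ x∈S₁) w₂)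
                               , (λ x∈S₂ → Answer-++ʳ disj m₁⊆m m₂⊆m x∈S₂ w₁ (r₂ x∈S₂))
                               ]′ (∈-++⁻ S₁ x∈)

  Answer-++ˡ disj m₁⊆m m₂⊆m x∈S₁ (answer {S₁′} S₁′⊆S₁ x∉S₁′ y∈S₁ y≢x w₁) w₂ =
    answer (Subset.++⁺ˡ _ S₁′⊆S₁)
      ([ x∉S₁′ , (λ x∈S₂ → disj (x∈S₁ , x∈S₂)) ]′ ∘ ∈-++⁻ S₁′)
      (∈-++⁺ˡ y∈S₁) y≢x
      (Win-++ (λ (z∈S₁′ , z∈S₂) → disj (S₁′⊆S₁ z∈S₁′ , z∈S₂))
        (Subset.∷⁺ʳ _ m₁⊆m) (there ∘ m₂⊆m) w₁ w₂)
  Answer-++ʳ {S₁} disj m₁⊆m m₂⊆m x∈S₂ w₁ (answer S₂′⊆S₂ x∉S₂′ y∈S₂ y≢x w₂) =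
    answer (Subset.++⁺ʳ S₁ S₂′⊆S₂)
      ([ (λ x∈S₁ → disj (x∈S₁ , x∈S₂)) , x∉S₂′ ]′ ∘ ∈-++⁻ S₁)
      (∈-++⁺ʳ S₁ y∈S₂) y≢x
      (Win-++ (λ (z∈S₁ , z∈S₂′) → disj (z∈S₁ , S₂′⊆S₂ z∈S₂′))
        (there ∘ m₁⊆m) (Subset.∷⁺ʳ _ m₂⊆m) w₁ w₂)

-- Pairing strategies

module _ {X : Set} where

  flatten : List (X × X) → List X
  flatten []             = []
  flatten ((y , z) ∷ ps) = y ∷ z ∷ flatten ps

  HitsPair : X × X → List X → Set
  HitsPair (y , z) m = y ∈ m ⊎ z ∈ m

  HitsPairs : List (X × X) → List X → Set
  HitsPairs ps m = All (λ p → HitsPair p m) ps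

  hitsPair : ∀ {y z} → y ≢ z → Win (HitsPair (y , z)) (y ∷ z ∷ []) []
  hitsPair {y} {z} y≢z = step (here refl) λ
    { (here refl)         → answer (λ ()) (λ ()) (there (here refl)) (y≢z ∘ sym)
                                   (done (inj₂ (here refl)))
    ; (there (here refl)) → answer (λ ()) (λ ()) (here refl) y≢z
                                   (done (inj₁ (here refl))) }

  -- The element not taken by the opponent is claimed in each pair, and disjoint pairs combine by
  -- `Win-++`. The list `m₀` carries along what was secured earlier, such as the reply to the
  -- opening move.
  pairing : ∀ ps m₀ → Unique (flatten ps) →
            Win (λ m → m₀ ⊆ m × HitsPairs ps m) (flatten ps) m₀
  pairing []             m₀ _ = done (⊆-refl , [])
  pairing ((y , z) ∷ ps) m₀ ((y≢z ∷ y≢) ∷ z≢ ∷ unique) =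
    Win-++ (λ m₁⊆m m₂⊆m hit (m₀⊆ , hits) →
              m₂⊆m ∘ m₀⊆ , ([ inj₁ ∘ m₁⊆m , inj₂ ∘ m₁⊆m ]′ hit) ∷
                           All.map ([ inj₁ ∘ m₂⊆m , inj₂ ∘ m₂⊆m ]′) hits)
      (λ { (here refl , x∈)         → All.lookup y≢ x∈ refl
         ; (there (here refl) , x∈) → All.lookup z≢ x∈ refl })
      (λ ()) ⊆-refl (hitsPair y≢z) (pairing ps m₀ unique)

-- From regional strategies to strategies of the Maker-Breaker game

module Play (P : PositionalGame) (first : Player) where
  open PositionalGame P
  open MakerBreaker P first
  open DecMembership _≟ₓ_ using (_∈?_)

  _≟ₚ_ : (p q : Player) → Dec (p ≡ q)
  maker   ≟ₚ maker   = yes refl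
  maker   ≟ₚ breaker = no λ ()
  breaker ≟ₚ maker   = no λ ()
  breaker ≟ₚ breaker = yes refl

  ≢⇒opponent : ∀ {p q} → p ≢ q → p ≡ opponent q
  ≢⇒opponent {maker}   {maker}   p≢q = contradiction refl p≢q
  ≢⇒opponent {maker}   {breaker} p≢q = refl
  ≢⇒opponent {breaker} {maker}   p≢q = refl
  ≢⇒opponent {breaker} {breaker} p≢q = contradiction refl p≢q

  opponent-≢ : ∀ p → p ≢ opponent p
  opponent-≢ maker   ()
  opponent-≢ breaker ()

  claimed⇒∈ : ∀ {p h x} → Claimed p h x → x ∈ h
  claimed⇒∈ (now _)     = here refl
  claimed⇒∈ (earlier c) = there (claimed⇒∈ c)

  ∈⇒claimed : ∀ p {h x} → x ∈ h → Claimed p h x ⊎ Claimed (opponent p) h x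
  ∈⇒claimed p {x ∷ h} (here refl) with toMove h ≟ₚ p
  ... | yes eq = inj₁ (now eq)
  ... | no neq = inj₂ (now (≢⇒opponent neq))
  ∈⇒claimed p (there x∈h) = [ inj₁ ∘ earlier , inj₂ ∘ earlier ]′ (∈⇒claimed p x∈h)

  fresh : ∀ {p σ h x} → Reachable p σ (x ∷ h) → x ∉ h
  fresh {σ = σ} (own {h = h} _ _ free refl) = proj₂ (σ h free)
  fresh (theirs _ _ free) = free

  previous : ∀ {p σ h x} → Reachable p σ (x ∷ h) → Reachable p σ h
  previous (own r _ _ _)  = r
  previous (theirs r _ _) = r

  -- Every move of a reachable history is fresh, so no element is claimed twice.
  ¬bothClaimed : ∀ {p q σ h x} → Reachable p σ h →
                 Claimed q h x → ¬ Claimed (opponent q) h x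
  ¬bothClaimed {q = q} _ (now eq) (now eq′) = opponent-≢ q (trans (sym eq) eq′)
  ¬bothClaimed r (now _)     (earlier c)  = fresh r (claimed⇒∈ c)
  ¬bothClaimed r (earlier c) (now _)      = fresh r (claimed⇒∈ c)
  ¬bothClaimed r (earlier c) (earlier c′) = ¬bothClaimed (previous r) c c′

  unclaimed : ∀ h → (∃[ x ] Free h x) ⊎ Complete h
  unclaimed h with any? (λ x → ¬? (x ∈? h)) elements
  ... | yes some = let x , _ , x∉h = find some in inj₁ (x , x∉h)
  ... | no  none = inj₂ λ x → decidable-stable (x ∈? h) λ x∉h → none (lose (enumerates x) x∉h)

  anyFree : ∀ h → .(∃[ x ] Free h x) → ∃[ x ] Free h x
  anyFree h free with unclaimed h
  ... | inj₁ x        = x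
  ... | inj₂ complete = contradiction-irr free λ (x , x∉h) → x∉h (complete x)

  module _ (σ τ : Strategy) where

    -- Playing two strategies against each other yields one full board reachable under both, on
    -- which the outcomes they guarantee can be compared. The list `rest` covers all unclaimed
    -- elements and shrinks with every move, which bounds the length of the play.
    playOut : ∃[ h ] (Reachable maker σ h × Reachable breaker τ h × Complete h)
    playOut = go (length elements) elements ≤-refl (λ x _ → enumerates x) start start
      where
      go : ∀ k rest {h} → length rest ≤ k → (∀ x → x ∉ h → x ∈ rest) →
           Reachable maker σ h → Reachable breaker τ h →
           ∃[ h′ ] (Reachable maker σ h′ × Reachable breaker τ h′ × Complete h′)
      next : ∀ k rest {h x} → x ∉ h → length rest ≤ k → (∀ x → x ∉ h → x ∈ rest) →
             Reachable maker σ (x ∷ h) → Reachable breaker τ (x ∷ h) →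
             ∃[ h′ ] (Reachable maker σ h′ × Reachable breaker τ h′ × Complete h′)
      go k rest {h} len cover rσ rτ with unclaimed h
      ... | inj₂ complete = h , rσ , rτ , complete
      ... | inj₁ free with toMove h in eq
      ...   | maker   = next k rest (proj₂ (σ h free)) len cover
                          (own rσ eq free refl) (theirs rτ eq (proj₂ (σ h free)))
      ...   | breaker = next k rest (proj₂ (τ h free)) len cover
                          (theirs rσ eq (proj₂ (τ h free))) (own rτ eq free refl)
      next zero    []   x∉h _   cover = contradiction (cover _ x∉h) λ ()
      next (suc k) rest {h} {x} x∉h len cover =
        go k (filter (λ z → ¬? (z ≟ₓ x)) rest)
          (s≤s⁻¹ (≤-trans (filter-notAll _ rest (lose (cover x x∉h) λ x≢x → x≢x refl)) len))
          (λ z z∉ → ∈-filter⁺ _ (cover z (z∉ ∘ there)) λ { refl → z∉ (here refl) })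

  module _ (p : Player) {G : List X → Set} where

    Position : Set
    Position = ∃[ S ] ∃[ m ] Win G S m

    advance : Position → X → Position
    advance t@(_ , _ , done _) x = t
    advance t@(S , _ , step _ r) x with x ∈? S
    ... | no  _   = t
    ... | yes x∈S with r x∈S
    ...   | answer _ _ _ _ w = _ , _ , w

    -- The position after the player's answer to the last move, even if that
    -- answer has not been played yet.
    position : Position → History → Position
    position t []      = t
    position t (x ∷ h) with toMove h ≟ₚ p
    ... | yes _ = position t h
    ... | no  _ = advance (position t h) x

    secured : Position → List X
    secured (_ , m , _) = m

    region : Position → List X
    region (S , _) = S

    -- The answer due is the secured element that is not on the board yet. If there is none, as
    -- after a move outside the region or when the answer is already owned, any free element will
    -- do, since an extra claim does no harm.
    follow : Position → Strategy
    follow t h free with any? (λ z → ¬? (z ∈? h)) (secured (position t h))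
    ... | yes some = let z , _ , z∉h = find some in z , z∉h
    ... | no  none = anyFree h free

    -- Secured elements may run ahead of the board by a single answer: at most one is missing when
    -- the player is to move, and none when the opponent is. Hence one move of `follow` always
    -- restores the balance, and the opponent never gets to take a secured element.
    record Invariant (h : History) (t : Position) : Set where
      field
        region-safe  : ∀ {z} → z ∈ region t → ¬ Claimed (opponent p) h z
        secured-safe : ∀ {z} → z ∈ secured t → ¬ Claimed (opponent p) h z
        settled      : toMove h ≡ opponent p → ∀ {z} → z ∈ secured t → z ∈ h
        pending      : toMove h ≡ p → ∀ {y z} → y ∈ secured t → z ∈ secured t →
                       y ∉ h → z ∉ h → y ≡ z
    open Invariant

    opponent-involutive : ∀ q → opponent (opponent q) ≡ q
    opponent-involutive maker   = refl
    opponent-involutive breaker = refl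

    safe-theirs : ∀ {h x z} → z ≢ x → ¬ Claimed (opponent p) h z →
                  ¬ Claimed (opponent p) (x ∷ h) z
    safe-theirs z≢x safe (now _)     = z≢x refl
    safe-theirs z≢x safe (earlier c) = safe c

    safe-own : ∀ {h x z} → toMove h ≡ p → ¬ Claimed (opponent p) h z →
               ¬ Claimed (opponent p) (x ∷ h) z
    safe-own eq safe (now eq′)   = opponent-≢ p (trans (sym eq) eq′)
    safe-own eq safe (earlier c) = safe c

    invariant-theirs : ∀ {h x} t → Invariant h t → toMove h ≡ opponent p → x ∉ h →
                       Invariant (x ∷ h) (advance t x)
    invariant-theirs {h} {x} t inv eq x∉h = advanced t inv
      where
      mine : opponent (toMove h) ≡ p
      mine = trans (cong opponent eq) (opponent-involutive p)

      -- Before the opponent's move all secured elements are on the board, whereas `x` was free.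
      old≢x : ∀ {t z} → Invariant h t → z ∈ secured t → z ≢ x
      old≢x inv z∈m refl = x∉h (settled inv eq z∈m)

      unchanged : ∀ t → x ∉ region t → Invariant h t → Invariant (x ∷ h) t
      unchanged t x∉S inv = record
        { region-safe  = λ z∈S → safe-theirs (λ { refl → x∉S z∈S }) (region-safe inv z∈S)
        ; secured-safe = λ z∈m → safe-theirs (old≢x inv z∈m) (secured-safe inv z∈m)
        ; settled      = λ eq′ → contradiction (trans (sym mine) eq′) (opponent-≢ p)
        ; pending      = λ _ y∈m _ y∉h → contradiction (there (settled inv eq y∈m)) y∉h
        }

      advanced : ∀ t → Invariant h t → Invariant (x ∷ h) (advance t x)
      advanced t@(_ , _ , done _) inv = unchanged t (λ ()) inv
      advanced t@(S , _ , step _ r) inv with x ∈? S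
      ... | no  x∉S = unchanged t x∉S inv
      ... | yes x∈S with r x∈S
      ...   | answer S′⊆S x∉S′ y∈S y≢x _ = record
        { region-safe  = λ z∈S′ → safe-theirs (λ { refl → x∉S′ z∈S′ })
                                              (region-safe inv (S′⊆S z∈S′))
        ; secured-safe = λ { (here refl) → safe-theirs y≢x (region-safe inv y∈S)
                           ; (there z∈m) → safe-theirs (old≢x inv z∈m) (secured-safe inv z∈m) }
        ; settled      = λ eq′ → contradiction (trans (sym mine) eq′) (opponent-≢ p)
        ; pending      = λ { _ (here refl) (here refl) _ _   → refl
                           ; _ (there y∈m) _           y∉h _ →
                               contradiction (there (settled inv eq y∈m)) y∉h
                           ; _ _           (there z∈m) _ z∉h →
                               contradiction (there (settled inv eq z∈m)) z∉h }
        }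

    invariant-own : ∀ {h t₀} (free : ∃[ y ] Free h y) → Invariant h (position t₀ h) →
                    toMove h ≡ p → Invariant (proj₁ (follow t₀ h free) ∷ h) (position t₀ h)
    invariant-own {h} {t₀} free inv eq = record
      { region-safe  = λ z∈S → safe-own eq (region-safe inv z∈S)
      ; secured-safe = λ z∈m → safe-own eq (secured-safe inv z∈m)
      ; settled      = λ _ → settled′
      ; pending      = λ eq′ → contradiction (trans (sym eq′) (cong opponent eq)) (opponent-≢ p)
      }
      where
      settled′ : ∀ {z} → z ∈ secured (position t₀ h) → z ∈ proj₁ (follow t₀ h free) ∷ h
      settled′ {z} z∈m with any? (λ z → ¬? (z ∈? h)) (secured (position t₀ h)) | z ∈? h
      ... | _        | yes z∈h = there z∈h
      ... | no  none | no  z∉h = contradiction (lose z∈m z∉h) none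
      ... | yes some | no  z∉h =
        let _ , y∈m , y∉h = find some in here (pending inv eq z∈m y∈m z∉h y∉h)

    invariant : ∀ {S} (w : Win G S []) {h} → Reachable p (follow (S , [] , w)) h →
                Invariant h (position (S , [] , w) h)
    invariant w start = record
      { region-safe = λ _ () ; secured-safe = λ () ; settled = λ _ () ; pending = λ _ () }
    invariant w (own {h} r eq free refl) with toMove h ≟ₚ p
    ... | yes _  = invariant-own free (invariant w r) eq
    ... | no neq = contradiction eq neq
    invariant w (theirs {h} r eq x∉h) with toMove h ≟ₚ p
    ... | yes eq′ = contradiction (trans (sym eq′) eq) (opponent-≢ p)
    ... | no _    = invariant-theirs _ (invariant w r) eq x∉h

    -- On a full board everything in the region belongs to the player, so the
    -- rest of the strategy can be run against imaginary moves of the opponent.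
    conclude : ∀ {Q : X → Set} {S m} → Win G S m → (∀ {z} → z ∈ S → Q z) →
               (∀ {z} → z ∈ m → Q z) → ∃[ m′ ] (G m′ × (∀ {z} → z ∈ m′ → Q z))
    conclude (done g) _ Qm = _ , g , Qm
    conclude (step x₀∈S r) QS Qm with r x₀∈S
    ... | answer S′⊆S _ y∈S _ w =
      conclude w (QS ∘ S′⊆S) λ { (here refl) → QS y∈S ; (there z∈m) → Qm z∈m }

    -- On a full board whatever the opponent does not own belongs to the player, so both safety
    -- clauses of `Invariant` become claims of the player, as `conclude` requires.
    follow-wins : ∀ {S} (w : Win G S []) {h} → Reachable p (follow (S , [] , w)) h →
                  Complete h → ∃[ m ] (G m × (∀ {z} → z ∈ m → Claimed p h z))
    follow-wins {S} w {h} r complete =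
      conclude (proj₂ (proj₂ t)) (claimed (region-safe inv)) (claimed (secured-safe inv))
      where
      t   = position (S , [] , w) h
      inv = invariant w r
      claimed : ∀ {z} {A : Set} → (A → ¬ Claimed (opponent p) h z) → A → Claimed p h z
      claimed {z} safe a = [ id , (λ c → contradiction c (safe a)) ]′ (∈⇒claimed p (complete z))

-- The greedy strategy in hypergraph games on ℕ

_∖_ : List ℕ → ℕ → List ℕ
A ∖ x = filterᵇ (λ z → not (x ≡ᵇ z)) A

_∈ᵇ_ : ℕ → List ℕ → Bool
x ∈ᵇ A = any (x ≡ᵇ_) A

avoid : ℕ → List (List ℕ) → List (List ℕ)
avoid x = filterᵇ (λ A → not (x ∈ᵇ A))

claim : ℕ → List (List ℕ) → List (List ℕ)
claim y = map (_∖ y)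

degree : ℕ → List (List ℕ) → ℕ
degree y []      = 0
degree y (A ∷ H) = if y ∈ᵇ A then suc (degree y H) else degree y H

busiest : List (List ℕ) → ℕ → ℕ → List ℕ → ℕ
busiest H y d []      = y
busiest H y d (z ∷ R) with degree z H
... | d′ = if d <ᵇ d′ then busiest H z d′ R else busiest H y d R

-- A singleton winning set {z} is a threat, which the opponent can only meet
-- by taking z.
sensible : List ℕ → List (List ℕ) → List ℕ
sensible R []             = R
sensible R ((z ∷ []) ∷ H) = if z ∈ᵇ R then [ z ] else sensible R H
sensible R (_ ∷ H)        = sensible R H

-- H lists what is still missing from the winning sets that the opponent has
-- not hit, and R the unclaimed elements.
greedyWins  : ℕ → List ℕ → List (List ℕ) → Bool
greedyReply : ℕ → List ℕ → List (List ℕ) → Bool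
greedyClaim : ℕ → ℕ → List ℕ → List (List ℕ) → Bool
greedyWins zero    R H = any null H
greedyWins (suc k) R H =
  any null H ∨ not (null R) ∧ all (λ x → greedyReply k (R ∖ x) (avoid x H)) (sensible R H)
greedyReply k []      H = false
greedyReply k (z ∷ R) H = greedyClaim k (busiest H z (degree z H) R) (z ∷ R) H
greedyClaim k y R H = greedyWins k (R ∖ y) (claim y H)

-- The hypergraph of Hamiltonian paths

permutations : {A : Set} → List A → List (List A)
insertions   : {A : Set} → A → List A → List (List A)
permutations []       = [ [] ]
permutations (x ∷ xs) = concatMap (insertions x) (permutations xs)
insertions x []       = [ [ x ] ]
insertions x (y ∷ ys) = (x ∷ y ∷ ys) ∷ map (y ∷_) (insertions x ys)

-- The unordered pair of i and j, for i and j below 8, packed into a single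
-- number for the sake of fast evaluation.
code : ℕ → ℕ → ℕ
code i j = (i ⊔ j) + (i ⊓ j) * 8

module _ {V X : Set} (e : V → V → X) where

  pathEdges : List V → List X
  pathEdges []           = []
  pathEdges (u ∷ [])     = []
  pathEdges (u ∷ v ∷ vs) = e u v ∷ pathEdges (v ∷ vs)

  edgesOn : List V → List X
  edgesOn []       = []
  edgesOn (v ∷ vs) = map (e v) vs ++ edgesOn vs

  HasPath : List V → List X → Set
  HasPath vs m = ∃[ p ] (p ↭ vs × Linked (λ u v → e u v ∈ m) p)

-- The Hamiltonian paths through the edge 12, traversed from 1 to 2, arise by
-- permuting these blocks.
blocks : ℕ → List (List ℕ)
blocks k = [ 0 ] ∷ (1 ∷ 2 ∷ []) ∷ map [_] (applyUpTo (3 +_) k)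

paths : ℕ → List (List ℕ)
paths k = map concat (permutations (blocks k))

-- The opponent has taken 01 and the player 12. Leaving out the paths that avoid 12 keeps the
-- evaluation sound, because having fewer winning sets never helps the player.
afterOpening : ℕ → List (List ℕ)
afterOpening k = claim (code 1 2) (avoid (code 0 1) (map (pathEdges code) (paths k)))

remaining : ℕ → List ℕ
remaining k = (edgesOn code (upTo (3 + k)) ∖ code 0 1) ∖ code 1 2

-- Soundness of the greedy evaluation

∈ᵇ⇒∈ : ∀ {x A} → T (x ∈ᵇ A) → x ∈ A
∈ᵇ⇒∈ {x} {A} t = Any.map (≡ᵇ⇒≡ x _) (Anyₚ.any⁻ (x ≡ᵇ_) A t)

∈-∖⁻ : ∀ A x {z} → z ∈ A ∖ x → z ∈ A × z ≢ x
∈-∖⁻ A x z∈ with z∈A , z≠x ← ∈-filter⁻ (T? ∘ (λ z → not (x ≡ᵇ z))) {xs = A} z∈ =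
  z∈A , λ { refl → not-T (x ≡ᵇ x) (≡⇒≡ᵇ x x refl) z≠x }
  where
  not-T : ∀ b → T b → ¬ T (not b)
  not-T true _ ()

∈-∖⁺ : ∀ {A x z} → z ∈ A → z ≢ x → z ∈ A ∖ x
∈-∖⁺ {x = x} {z} z∈A z≢x =
  ∈-filter⁺ (T? ∘ (λ z → not (x ≡ᵇ z))) z∈A (T-not (x ≡ᵇ z) (z≢x ∘ sym ∘ ≡ᵇ⇒≡ x z))
  where
  T-not : ∀ b → ¬ T b → T (not b)
  T-not false _  = _
  T-not true  ¬t = ¬t _

busiest-∈ : ∀ H y d R → busiest H y d R ∈ y ∷ R
busiest-∈ H y d []      = here refl
busiest-∈ H y d (z ∷ R) with degree z H
... | d′ with d <ᵇ d′
...   | true  = there (busiest-∈ H z d′ R)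
...   | false = skip (busiest-∈ H y d R)
  where
  skip : ∀ {w} → w ∈ y ∷ R → w ∈ y ∷ z ∷ R
  skip (here eq)  = here eq
  skip (there w∈) = there (there w∈)

-- This justifies the pruning: a move discarded by `sensible` leaves some threat `z` open, which the
-- player carries out at once.
sensible-or-threat : ∀ R H {x} → x ∈ R →
                     x ∈ sensible R H ⊎ ∃[ z ] (z ≢ x × z ∈ R × [ z ] ∈ H)
sensible-or-threat R []             x∈R = inj₁ x∈R
sensible-or-threat R ([] ∷ H)       x∈R with sensible-or-threat R H x∈R
... | inj₁ x∈               = inj₁ x∈
... | inj₂ (_ , ≢x , ∈R , ∈H) = inj₂ (_ , ≢x , ∈R , there ∈H)
sensible-or-threat R ((_ ∷ _ ∷ _) ∷ H) x∈R with sensible-or-threat R H x∈R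
... | inj₁ x∈               = inj₁ x∈
... | inj₂ (_ , ≢x , ∈R , ∈H) = inj₂ (_ , ≢x , ∈R , there ∈H)
sensible-or-threat R ((z ∷ []) ∷ H) {x} x∈R with z ∈ᵇ R in eq
... | false with sensible-or-threat R H x∈R
...   | inj₁ x∈                 = inj₁ x∈
...   | inj₂ (_ , ≢x , ∈R , ∈H) = inj₂ (_ , ≢x , ∈R , there ∈H)
sensible-or-threat R ((z ∷ []) ∷ H) {x} x∈R | true with z ≟ x
... | yes refl = inj₁ (here refl)
... | no  z≢x  = inj₂ (z , z≢x , ∈ᵇ⇒∈ (subst T (sym eq) _) , here refl)

module _ (G : List ℕ → Set) where

  -- A is what remains to be added to m in order to achieve G.
  Completes : List ℕ → List ℕ → Set
  Completes m A = ∀ {m′} → m ⊆ m′ → A ⊆ m′ → G m′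

  Completes-claim : ∀ {m A} y → Completes m A → Completes (y ∷ m) (A ∖ y)
  Completes-claim y c m⊆ A⊆ = c (m⊆ ∘ there) λ {z} z∈A → by-cases (z ≟ y) z∈A
    where
    by-cases : ∀ {z} → Dec (z ≡ y) → z ∈ _ → z ∈ _
    by-cases (yes refl) _   = m⊆ (here refl)
    by-cases (no z≢y)   z∈A = A⊆ (∈-∖⁺ z∈A z≢y)

  All-claim : ∀ {m} y {H} → All (Completes m) H → All (Completes (y ∷ m)) (claim y H)
  All-claim y cs = Allₚ.map⁺ (All.map (λ {A} → Completes-claim {A = A} y) cs)

  All-avoid : ∀ {m} x {H} → All (Completes m) H → All (Completes m) (avoid x H)
  All-avoid x = Allₚ.filter⁺ (T? ∘ (λ A → not (x ∈ᵇ A)))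

  -- A successful evaluation is read as a strategy tree, with `k` bounding the number of rounds.
  -- Nothing about `busiest` matters here except that it picks an unclaimed element.
  greedyWins-sound : ∀ k R H {m} → All (Completes m) H → T (greedyWins k R H) →
                     Wins G R m
  greedyReply-sound : ∀ k {x R₀} R H {m} → R ⊆ R₀ → x ∉ R →
                      All (Completes m) H → T (greedyReply k R H) → Answer G R₀ x m

  null-sound : ∀ {H m} → All (Completes m) H → T (any null H) → G m
  null-sound {H} cs t with find (Anyₚ.any⁻ null H t)
  ... | [] , []∈H , _ = All.lookup cs []∈H ⊆-refl λ ()

  greedyWins-sound zero    R H cs t = [] , (λ ()) , done (null-sound cs t)
  greedyWins-sound (suc k) R H cs t with Equivalence.to (T-∨ {any null H}) t
  ... | inj₁ null!  = [] , (λ ()) , done (null-sound cs null!)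
  greedyWins-sound (suc k) (x₀ ∷ R) H cs t | inj₂ replies =
    x₀ ∷ R , ⊆-refl , step (here refl) λ x∈R → respond x∈R (sensible-or-threat (x₀ ∷ R) H x∈R)
    where
    respond : ∀ {x} → x ∈ x₀ ∷ R →
              x ∈ sensible (x₀ ∷ R) H ⊎ ∃[ z ] (z ≢ x × z ∈ x₀ ∷ R × [ z ] ∈ H) →
              Answer G (x₀ ∷ R) x _
    respond {x} _ (inj₁ x∈) =
      greedyReply-sound k ((x₀ ∷ R) ∖ x) (avoid x H)
        (proj₁ ∘ ∈-∖⁻ (x₀ ∷ R) x) (λ x∈∖x → proj₂ (∈-∖⁻ (x₀ ∷ R) x x∈∖x) refl)
        (All-avoid x cs) (All.lookup (Allₚ.all⁺ _ _ replies) x∈)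
    respond _ (inj₂ (z , z≢x , z∈R , [z]∈H)) =
      answer {S′ = []} (λ ()) (λ ()) z∈R z≢x
        (done (All.lookup cs [z]∈H there λ { (here refl) → here refl }))

  greedyReply-sound k (z ∷ R) H R⊆R₀ x∉R cs t =
    let y             = busiest H z (degree z H) R
        y∈R           = busiest-∈ H z (degree z H) R
        S , S⊆ , w = greedyWins-sound k ((z ∷ R) ∖ y) (claim y H) (All-claim y cs) t
        S⊆R           = λ {u} (u∈S : u ∈ S) → proj₁ (∈-∖⁻ (z ∷ R) y (S⊆ u∈S))
    in answer (R⊆R₀ ∘ S⊆R) (x∉R ∘ S⊆R) (R⊆R₀ y∈R) (λ { refl → x∉R y∈R }) w

insertions-↭ : ∀ {A : Set} (x : A) ys → All (_↭ x ∷ ys) (insertions x ys)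
insertions-↭ x []       = refl ∷ []
insertions-↭ x (y ∷ ys) =
  refl ∷ Allₚ.map⁺ (All.map (λ p → ↭-trans (prep y p) (swap y x refl)) (insertions-↭ x ys))

permutations-↭ : ∀ {A : Set} (xs : List A) → All (_↭ xs) (permutations xs)
permutations-↭ []       = refl ∷ []
permutations-↭ (x ∷ xs) = Allₚ.concat⁺ (Allₚ.map⁺
  (All.map (λ p → All.map (λ q → ↭-trans q (prep x p)) (insertions-↭ x _)) (permutations-↭ xs)))

concat-↭ : ∀ {A : Set} {xss yss : List (List A)} → xss ↭ yss → concat xss ↭ concat yss
concat-↭ refl            = refl
concat-↭ (prep xs p)     = Perm.++⁺ˡ xs (concat-↭ p)
concat-↭ (swap xs ys p)  = ↭-trans (shifts xs ys) (Perm.++⁺ˡ ys (Perm.++⁺ˡ xs (concat-↭ p)))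
concat-↭ (_↭_.trans p q) = ↭-trans (concat-↭ p) (concat-↭ q)

concat-blocks : ∀ k → concat (blocks k) ≡ upTo (3 + k)
concat-blocks k = cong (λ is → 0 ∷ 1 ∷ 2 ∷ is) (concat-map-[ applyUpTo (3 +_) k ])

paths-↭ : ∀ k → All (_↭ upTo (3 + k)) (paths k)
paths-↭ k = Allₚ.map⁺ (All.map
  (λ {p} p↭ → subst (concat p ↭_) (concat-blocks k) (concat-↭ p↭))
  (permutations-↭ (blocks k)))

pathEdges⇒Linked : ∀ {V X : Set} {e : V → V → X} {m} p → pathEdges e p ⊆ m →
                   Linked (λ u v → e u v ∈ m) p
pathEdges⇒Linked []           _ = []
pathEdges⇒Linked (u ∷ [])     _ = [-]
pathEdges⇒Linked (u ∷ v ∷ vs) ⊆m =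
  ⊆m (here refl) ∷ pathEdges⇒Linked (v ∷ vs) (⊆m ∘ there)

greedy-HasPath : ∀ k n → greedyWins k (remaining n) (afterOpening n) ≡ true →
  Wins (HasPath code (upTo (3 + n))) (remaining n) [ code 1 2 ]
greedy-HasPath k n eq = greedyWins-sound _ k (remaining n) (afterOpening n)
  (All-claim G (code 1 2) (All-avoid G (code 0 1) (Allₚ.map⁺ (All.map completes (paths-↭ n)))))
  (subst T (sym eq) _)
  where
  G = HasPath code (upTo (3 + n))
  completes : ∀ {p} → p ↭ upTo (3 + n) → Completes G [] (pathEdges code p)
  completes {p} p↭ _ edges⊆m = p , p↭ , pathEdges⇒Linked p edges⊆m

abstract
  -- Of the 10 edges on five vertices the opening uses two; the other 8 last for 4 rounds.
  greedy₅ : greedyWins 4 (remaining 2) (afterOpening 2) ≡ true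
  greedy₅ = refl

  -- Of the 15 edges on six vertices 13 are left after the opening, enough for 6 full rounds.
  greedy₆ : greedyWins 6 (remaining 3) (afterOpening 3) ≡ true
  greedy₆ = refl

-- Lists, edges of a vertex list, and numbered vertices

Unique-resp-↭ : ∀ {A : Set} {xs ys : List A} → xs ↭ ys → Unique xs → Unique ys
Unique-resp-↭ p = PermSetoid.Unique-resp-↭ (setoid _) (↭⇒↭ₛ p)

∈⇒↭∷ : ∀ {A : Set} {x : A} {xs} → x ∈ xs → ∃[ ys ] xs ↭ x ∷ ys
∈⇒↭∷ x∈xs with ys , zs , refl ← ∈-∃++ x∈xs = ys ++ zs , shift _ ys zs

-- The two chains are glued at their common element `z`; this lets a path grow at its far end.
Linked-∷ʳ : ∀ {A : Set} {R : A → A → Set} xs {z ys} →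
            Linked R (xs ∷ʳ z) → Linked R (z ∷ ys) → Linked R (xs ++ z ∷ ys)
Linked-∷ʳ []           _       q = q
Linked-∷ʳ (x ∷ [])     (r ∷ _) q = r ∷ q
Linked-∷ʳ (x ∷ y ∷ xs) (r ∷ p) q = r ∷ Linked-∷ʳ (y ∷ xs) p q

Linked-map-∈ : ∀ {A : Set} {R S : A → A → Set} {xs} →
               (∀ {x y} → x ∈ xs → y ∈ xs → R x y → S x y) → Linked R xs → Linked S xs
Linked-map-∈ f []      = []
Linked-map-∈ f [-]     = [-]
Linked-map-∈ f (r ∷ p) =
  f (here refl) (there (here refl)) r ∷ Linked-map-∈ (λ x∈ y∈ → f (there x∈) (there y∈)) p

module _ {V X : Set} (e : V → V → X) where

  ∈-edgesOn⁻ : ∀ {vs x} → Unique vs → x ∈ edgesOn e vs →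
               ∃[ u ] ∃[ v ] (u ∈ vs × v ∈ vs × u ≢ v × x ≡ e u v)
  ∈-edgesOn⁻ {v ∷ vs} (v∉ ∷ unique) x∈ with ∈-++⁻ (map (e v) vs) x∈
  ... | inj₁ x∈v with w , w∈vs , x≡ ← ∈-map⁻ (e v) x∈v =
    v , w , here refl , there w∈vs , All.lookup v∉ w∈vs , x≡
  ... | inj₂ x∈vs with u , w , u∈ , w∈ , u≢w , x≡ ← ∈-edgesOn⁻ unique x∈vs =
    u , w , there u∈ , there w∈ , u≢w , x≡

  module _ (e-comm : ∀ u v → e u v ≡ e v u) where

    ∈-edgesOn⁺ : ∀ {vs u v} → u ∈ vs → v ∈ vs → u ≢ v → e u v ∈ edgesOn e vs
    ∈-edgesOn⁺ (here refl) (here refl) u≢v = contradiction refl u≢v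
    ∈-edgesOn⁺ (here refl) (there v∈)  _   = ∈-++⁺ˡ (∈-map⁺ (e _) v∈)
    ∈-edgesOn⁺ (there u∈)  (here refl) _   =
      ∈-++⁺ˡ (subst (_∈ map (e _) _) (e-comm _ _) (∈-map⁺ (e _) u∈))
    ∈-edgesOn⁺ {w ∷ vs} (there u∈) (there v∈) u≢v =
      ∈-++⁺ʳ (map (e w) vs) (∈-edgesOn⁺ u∈ v∈ u≢v)

    edgesOn-⊆ : ∀ {us vs} → Unique us → us ⊆ vs → edgesOn e us ⊆ edgesOn e vs
    edgesOn-⊆ unique us⊆vs x∈ with u , v , u∈ , v∈ , u≢v , refl ← ∈-edgesOn⁻ unique x∈ =
      ∈-edgesOn⁺ (us⊆vs u∈) (us⊆vs v∈) u≢v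

code-comm : ∀ i j → code i j ≡ code j i
code-comm i j = cong₂ (λ k l → k + l * 8) (⊔-comm i j) (⊓-comm i j)

-- The vertex v is a junk value, taken at the indices past the end of the list.
vertexAt : ∀ {V : Set} → V → List V → ℕ → V
vertexAt v []       _       = v
vertexAt v (u ∷ us) zero    = u
vertexAt v (u ∷ us) (suc i) = vertexAt v us i

vertexAt-∈ : ∀ {V : Set} (v : V) us {i} → i < length us → vertexAt v us i ∈ us
vertexAt-∈ v (u ∷ us) {zero}  _   = here refl
vertexAt-∈ v (u ∷ us) {suc i} i<n = there (vertexAt-∈ v us (s<s⁻¹ i<n))

vertexAt-injective : ∀ {V : Set} (v : V) {us i j} → Unique us → i < length us → j < length us →
                     vertexAt v us i ≡ vertexAt v us j → i ≡ j
vertexAt-injective v {u ∷ us} {zero}  {zero}  _ _ _ _ = refl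
vertexAt-injective v {u ∷ us} {zero}  {suc j} (u∉ ∷ _) _ j<n eq =
  contradiction eq (All.lookup u∉ (vertexAt-∈ v us (s<s⁻¹ j<n)))
vertexAt-injective v {u ∷ us} {suc i} {zero}  (u∉ ∷ _) i<n _ eq =
  contradiction (sym eq) (All.lookup u∉ (vertexAt-∈ v us (s<s⁻¹ i<n)))
vertexAt-injective v {u ∷ us} {suc i} {suc j} (_ ∷ unique) i<n j<n eq =
  cong suc (vertexAt-injective v unique (s<s⁻¹ i<n) (s<s⁻¹ j<n) eq)

map-vertexAt : ∀ {V : Set} (v : V) us → map (vertexAt v us) (upTo (length us)) ≡ us
map-vertexAt v us = trans (map-upTo _ _) (go us)
  where
  go : ∀ us → applyUpTo (vertexAt v us) (length us) ≡ us
  go []       = refl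
  go (u ∷ us) = cong (u ∷_) (go us)

-- The Hamiltonian path game on an arbitrary set of vertices

module Graph {V X : Set} (e : V → V → X) (e-comm : ∀ u v → e u v ≡ e v u)
  (e-injective : ∀ {u v u′ v′} → u ≢ v → u′ ≢ v′ → e u v ≡ e u′ v′ →
                 (u ≡ u′ × v ≡ v′) ⊎ (u ≡ v′ × v ≡ u′)) where

  -- The vertices form a list rather than a type, so that the induction can drop two of them without
  -- changing the type of the edges.
  WinsPath : List V → Set
  WinsPath vs = Wins (HasPath e vs) (edgesOn e vs) []

  Answered : List V → V → V → V → List V → Set
  Answered vs a b c us =
    ∃[ S ] (S ⊆ edgesOn e (a ∷ b ∷ c ∷ us) × e a b ∉ S × Win (HasPath e vs) S [ e b c ])

  -- Up to the order of the vertices, the opponent opens with ab and the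
  -- player replies with bc.
  opening : ∀ {vs} → Unique vs → length vs ≥ 3 →
            (∀ {a b c us} → vs ↭ a ∷ b ∷ c ∷ us → Answered vs a b c us) →
            WinsPath vs
  opening {_ ∷ []} _ (s≤s ())
  opening {vs@(_ ∷ _ ∷ _)} unique len≥3 afterReply =
    edgesOn e vs , ⊆-refl , step (here refl) λ x∈ → reply (∈-edgesOn⁻ e unique x∈)
    where
    reply : ∀ {x} → ∃[ u ] ∃[ v ] (u ∈ vs × v ∈ vs × u ≢ v × x ≡ e u v) →
            Answer (HasPath e vs) (edgesOn e vs) x []
    reply (a , b , a∈ , b∈ , a≢b , refl)
      with us , vs↭ ← ∈⇒↭∷ a∈
      with ∈-resp-↭ vs↭ b∈
    ... | here b≡a = contradiction (sym b≡a) a≢b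
    ... | there b∈us with ∈⇒↭∷ b∈us
    ...   | [] , us↭ =
      contradiction (subst (3 ≤_) (↭-length (↭-trans vs↭ (prep a us↭))) len≥3)
                    λ { (s≤s (s≤s ())) }
    -- Any third vertex can serve as `c`; the head of the remaining list is taken.
    ...   | c ∷ ws , us↭ with Unique-resp-↭ (↭-trans vs↭ (prep a us↭)) unique
    ...     | unique′@((_ ∷ a≢c ∷ _) ∷ (b≢c ∷ _) ∷ _) =
      let vs↭′ = ↭-trans vs↭ (prep a us↭)
          S , S⊆ , ab∉S , w = afterReply vs↭′
          ⊆vs = λ {v} → ∈-resp-↭ {x = v} (↭-sym vs↭′)
      in answer (edgesOn-⊆ e e-comm unique′ ⊆vs ∘ S⊆) ab∉S
           (∈-edgesOn⁺ e e-comm (⊆vs (there (here refl))) (⊆vs (there (there (here refl)))) b≢c)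
           (λ bc≡ab → [ (λ (b≡a , _) → a≢b (sym b≡a)) , (λ (_ , c≡a) → a≢c (sym c≡a)) ]′
                        (e-injective b≢c a≢b bc≡ab))
           w

  -- Transfer from numbered edges to the edges of a graph

  module _ {vs : List V} (unique : Unique vs) (u₀ : V) (len≤8 : length vs ≤ 8) where

    vertex : ℕ → V
    vertex = vertexAt u₀ vs

    decode : ℕ → X
    decode k = e (vertex (k / 8)) (vertex (k % 8))

    -- In base 8 the digits of `code i j` are the minimum and the maximum of `i` and `j`. The
    -- endpoints are thus recovered up to order, which `e-comm` disregards.
    decode-code : ∀ {i j} → i < 8 → j < 8 → decode (code i j) ≡ e (vertex i) (vertex j)
    decode-code {i} {j} i<8 j<8 = trans (cong₂ (λ k l → e (vertex k) (vertex l)) quot rem) ordered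
      where
      max<8 : i ⊔ j < 8
      max<8 = ⊔-lub i<8 j<8
      quot : code i j / 8 ≡ i ⊓ j
      quot = trans (+-distrib-/-∣ʳ (i ⊔ j) (n∣m*n (i ⊓ j)))
                   (cong₂ _+_ (m<n⇒m/n≡0 max<8) (m*n/n≡m (i ⊓ j) 8))
      rem : code i j % 8 ≡ i ⊔ j
      rem = trans ([m+kn]%n≡m%n (i ⊔ j) (i ⊓ j) 8) (m<n⇒m%n≡m max<8)
      ordered : e (vertex (i ⊓ j)) (vertex (i ⊔ j)) ≡ e (vertex i) (vertex j)
      ordered with ≤-total i j
      ... | inj₁ i≤j rewrite m≤n⇒m⊓n≡m i≤j | m≤n⇒m⊔n≡n i≤j = refl
      ... | inj₂ j≤i rewrite m≥n⇒m⊓n≡n j≤i | m≥n⇒m⊔n≡m j≤i = e-comm _ _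

    ∈-codes⁻ : ∀ {k} → k ∈ edgesOn code (upTo (length vs)) →
               ∃[ i ] ∃[ j ] (i < length vs × j < length vs × vertex i ≢ vertex j ×
                              k ≡ code i j × decode k ≡ e (vertex i) (vertex j))
    ∈-codes⁻ k∈ with i , j , i∈ , j∈ , i≢j , refl ← ∈-edgesOn⁻ code (upTo⁺ (length vs)) k∈ =
      i , j , i< , j< , i≢j ∘ vertexAt-injective u₀ unique i< j< , refl ,
      decode-code (≤-trans i< len≤8) (≤-trans j< len≤8)
      where
      i< = ∈-upTo⁻ i∈
      j< = ∈-upTo⁻ j∈

    decode-injective : ∀ {k l} → k ∈ edgesOn code (upTo (length vs)) →
                       l ∈ edgesOn code (upTo (length vs)) → decode k ≡ decode l → k ≡ l
    decode-injective k∈ l∈ eq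
      with i , j , i< , j< , i≢j , refl , k≡ ← ∈-codes⁻ k∈
         | i′ , j′ , i′< , j′< , i′≢j′ , refl , l≡ ← ∈-codes⁻ l∈
      with e-injective i≢j i′≢j′ (trans (sym k≡) (trans eq l≡))
    ... | inj₁ (i≡ , j≡) = cong₂ code (vertexAt-injective u₀ unique i< i′< i≡)
                                      (vertexAt-injective u₀ unique j< j′< j≡)
    ... | inj₂ (i≡ , j≡) = trans (code-comm i j)
      (cong₂ code (vertexAt-injective u₀ unique j< i′< j≡)
                  (vertexAt-injective u₀ unique i< j′< i≡))

    decode-edges : ∀ {k} → k ∈ edgesOn code (upTo (length vs)) → decode k ∈ edgesOn e vs
    decode-edges k∈ with i , j , i< , j< , i≢j , _ , k≡ ← ∈-codes⁻ k∈ =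
      subst (_∈ edgesOn e vs) (sym k≡)
        (∈-edgesOn⁺ e e-comm (vertexAt-∈ u₀ vs i<) (vertexAt-∈ u₀ vs j<) i≢j)

    decode-HasPath : ∀ {vs₀ m} → vs₀ ↭ vs → HasPath code (upTo (length vs)) m →
                     HasPath e vs₀ (map decode m)
    decode-HasPath {m = m} vs₀↭ (p , p↭ , linked) =
      map vertex p ,
      ↭-trans (subst (map vertex p ↭_) (map-vertexAt u₀ vs) (Perm.map⁺ vertex p↭)) (↭-sym vs₀↭) ,
      Linkedₚ.map⁺ (Linked-map-∈ (λ i∈ j∈ ij∈m →
        subst (_∈ map decode m) (decode-code (<8 i∈) (<8 j∈)) (∈-map⁺ decode ij∈m)) linked)
      where
      <8 : ∀ {i} → i ∈ p → i < 8
      <8 i∈p = ≤-trans (∈-upTo⁻ (∈-resp-↭ p↭ i∈p)) len≤8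

  winsPath-greedy : ∀ k n → n ≤ 5 → greedyWins k (remaining n) (afterOpening n) ≡ true →
                    ∀ {vs} → Unique vs → length vs ≡ 3 + n → WinsPath vs
  winsPath-greedy k n n≤5 greedy {vs} unique len =
    opening unique (subst (3 ≤_) (sym len) (m≤m+n 3 _)) reply
    where
    reply : ∀ {a b c us} → vs ↭ a ∷ b ∷ c ∷ us → Answered vs a b c us
    reply {a} {b} {c} {us} vs↭ = go (trans (sym len) (↭-length vs↭)) greedy n≤5
      where
      unique′ = Unique-resp-↭ vs↭ unique
      -- With `n` generalised, matching the equation against `refl` replaces `n` by the length of
      -- `us`.
      go : ∀ {n} → 3 + n ≡ length (a ∷ b ∷ c ∷ us) →
           greedyWins k (remaining n) (afterOpening n) ≡ true → n ≤ 5 →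
           Answered vs a b c us
      go {n} refl greedy n≤5 with S , S⊆ , w ← greedy-HasPath k n greedy =
        map dec S , dec-⊆ , ab∉ , Win-map dec (decode-HasPath unique′ a len≤8 vs↭) dec-injective w
        where
        len≤8 = s≤s (s≤s (s≤s n≤5))
        dec = decode unique′ a len≤8

        codes = edgesOn code (upTo (3 + n))

        S⊆codes∖01 : S ⊆ codes ∖ code 0 1
        S⊆codes∖01 k∈S = proj₁ (∈-∖⁻ (codes ∖ code 0 1) (code 1 2) (S⊆ k∈S))

        S⊆codes : S ⊆ codes
        S⊆codes k∈S = proj₁ (∈-∖⁻ codes (code 0 1) (S⊆codes∖01 k∈S))

        01∉S : code 0 1 ∉ S
        01∉S 01∈S = proj₂ (∈-∖⁻ codes (code 0 1) (S⊆codes∖01 01∈S)) refl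

        dec-injective : ∀ {k l} → k ∈ S → l ∈ S → dec k ≡ dec l → k ≡ l
        dec-injective k∈ l∈ = decode-injective unique′ a len≤8 (S⊆codes k∈) (S⊆codes l∈)

        dec-⊆ : map dec S ⊆ edgesOn e (a ∷ b ∷ c ∷ us)
        dec-⊆ x∈ with k , k∈S , refl ← ∈-map⁻ dec x∈ =
          decode-edges unique′ a len≤8 (S⊆codes k∈S)

        ab∉ : e a b ∉ map dec S
        -- The edge `e a b` is, by computation, the decoding of `code 0 1`, which is the first entry
        -- of `codes`.
        ab∉ ab∈ with k , k∈S , ab≡ ← ∈-map⁻ dec ab∈ = 01∉S (subst (_∈ S)
          (sym (decode-injective unique′ a len≤8 (here refl) (S⊆codes k∈S) ab≡)) k∈S)

  -- Extending a path by two vertices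

  module _ {a b c : V} {us : List V} (unique : Unique (a ∷ b ∷ c ∷ us)) where

    joinTo : V → X × X
    joinTo u = e u b , e u c

    joins⁻ : ∀ ws {x} → x ∈ flatten (map joinTo ws) → ∃[ w ] (w ∈ ws × (x ≡ e w b ⊎ x ≡ e w c))
    joins⁻ (w ∷ ws) (here x≡)          = w , here refl , inj₁ x≡
    joins⁻ (w ∷ ws) (there (here x≡))  = w , here refl , inj₂ x≡
    joins⁻ (w ∷ ws) (there (there x∈)) with v , v∈ , x≡ ← joins⁻ ws x∈ = v , there v∈ , x≡

    a≢b : a ≢ b
    a≢b = unique |> λ { ((a≢b ∷ _) ∷ _) → a≢b }

    a≢c : a ≢ c
    a≢c = unique |> λ { ((_ ∷ a≢c ∷ _) ∷ _) → a≢c }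

    b≢c : b ≢ c
    b≢c = unique |> λ { (_ ∷ (b≢c ∷ _) ∷ _) → b≢c }

    b∉ : b ∉ a ∷ us
    b∉ (here b≡a) = a≢b (sym b≡a)
    b∉ (there b∈) = unique |> λ { (_ ∷ (_ ∷ b∉us) ∷ _) → All.lookup b∉us b∈ refl }

    c∉ : c ∉ a ∷ us
    c∉ (here c≡a) = a≢c (sym c≡a)
    c∉ (there c∈) = unique |> λ { (_ ∷ _ ∷ c∉us ∷ _) → All.lookup c∉us c∈ refl }

    a∉us : a ∉ us
    a∉us a∈ = unique |> λ { ((_ ∷ _ ∷ a∉) ∷ _) → All.lookup a∉ a∈ refl }

    ≢b : ∀ {u} → u ∈ us → u ≢ b
    ≢b u∈ refl = b∉ (there u∈)

    ≢c : ∀ {u} → u ∈ us → u ≢ c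
    ≢c u∈ refl = c∉ (there u∈)

    unique-a∷us : Unique (a ∷ us)
    unique-a∷us = unique |> λ { ((_ ∷ _ ∷ a∉) ∷ _ ∷ _ ∷ u) → a∉ ∷ u }

    unique-us : Unique us
    unique-us = unique |> λ { (_ ∷ _ ∷ _ ∷ u) → u }

    unique-joins : ∀ ws → ws ⊆ us → Unique ws → Unique (flatten (map joinTo ws))
    unique-joins []       _   _             = []
    unique-joins (w ∷ ws) ws⊆ (w∉ ∷ unique) =
      (wb≢wc ∷ All.tabulate (distinct w≢b)) ∷ All.tabulate (distinct w≢c) ∷
      unique-joins ws (ws⊆ ∘ there) unique
      where
      w≢b = ≢b (ws⊆ (here refl))
      w≢c = ≢c (ws⊆ (here refl))
      wb≢wc : e w b ≢ e w c
      wb≢wc eq = [ (λ (_ , b≡c) → b≢c b≡c) , (λ (w≡c , _) → w≢c w≡c) ]′ (e-injective w≢b w≢c eq)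
      distinct : ∀ {d x} → w ≢ d → x ∈ flatten (map joinTo ws) → e w d ≢ x
      distinct w≢d x∈ refl with joins⁻ ws x∈
      ... | v , v∈ , inj₁ eq with e-injective w≢d (≢b (ws⊆ (there v∈))) eq
      ...   | inj₁ (w≡v , _) = All.lookup w∉ v∈ w≡v
      ...   | inj₂ (w≡b , _) = w≢b w≡b
      distinct w≢d x∈ refl | v , v∈ , inj₂ eq with e-injective w≢d (≢c (ws⊆ (there v∈))) eq
      ...   | inj₁ (w≡v , _) = All.lookup w∉ v∈ w≡v
      ...   | inj₂ (w≡c , _) = w≢c w≡c

    -- The edges within `a ∷ us` miss `b` and `c`, while each paired edge meets one of them, so the
    -- two strategies have disjoint regions. The vertex `a` gets no pair because `ab` is already the
    -- opponent's.
    pairingReply : length us ≥ 3 → WinsPath (a ∷ us) → ∀ {vs} → vs ↭ a ∷ b ∷ c ∷ us →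
                 Answered vs a b c us
    pairingReply len≥3 (S , S⊆ , w) {vs} vs↭ =
      S ++ flatten (map joinTo us) , region-⊆ , ab∉ ,
      Win-++ goal disjoint (λ ()) ⊆-refl w
        (pairing (map joinTo us) [ e b c ] (unique-joins us ⊆-refl unique-us))
      where
      ⊆vs : a ∷ us ⊆ a ∷ b ∷ c ∷ us
      ⊆vs (here refl) = here refl
      ⊆vs (there u∈)  = there (there (there u∈))

      region-⊆ : S ++ flatten (map joinTo us) ⊆ edgesOn e (a ∷ b ∷ c ∷ us)
      region-⊆ x∈ with ∈-++⁻ S x∈
      ... | inj₁ x∈S = edgesOn-⊆ e e-comm unique-a∷us ⊆vs (S⊆ x∈S)
      ... | inj₂ x∈j with joins⁻ us x∈j
      ...   | w , w∈ , inj₁ refl =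
        ∈-edgesOn⁺ e e-comm (⊆vs (there w∈)) (there (here refl)) (≢b w∈)
      ...   | w , w∈ , inj₂ refl =
        ∈-edgesOn⁺ e e-comm (⊆vs (there w∈)) (there (there (here refl))) (≢c w∈)

      ∉S : ∀ {w d} → d ∉ a ∷ us → w ≢ d → e w d ∉ S
      ∉S d∉ w≢d wd∈S with u , v , u∈ , v∈ , u≢v , eq ← ∈-edgesOn⁻ e unique-a∷us (S⊆ wd∈S)
        with e-injective w≢d u≢v eq
      ... | inj₁ (_ , refl) = d∉ v∈
      ... | inj₂ (_ , refl) = d∉ u∈

      ab∉ : e a b ∉ S ++ flatten (map joinTo us)
      ab∉ ab∈ with ∈-++⁻ S ab∈
      ... | inj₁ ab∈S = ∉S b∉ a≢b ab∈S
      ... | inj₂ ab∈j with joins⁻ us ab∈j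
      ...   | w , w∈ , inj₁ eq = [ (λ { (refl , _) → a∉us w∈ }) , (λ (a≡b , _) → a≢b a≡b) ]′
                                   (e-injective a≢b (≢b w∈) eq)
      ...   | w , w∈ , inj₂ eq = [ (λ { (refl , _) → a∉us w∈ }) , (λ (a≡c , _) → a≢c a≡c) ]′
                                   (e-injective a≢b (≢c w∈) eq)

      disjoint : Disjoint S (flatten (map joinTo us))
      disjoint (x∈S , x∈j) with joins⁻ us x∈j
      ... | w , w∈ , inj₁ refl = ∉S b∉ (≢b w∈) x∈S
      ... | w , w∈ , inj₂ refl = ∉S c∉ (≢c w∈) x∈S

      bc∷ : ∀ {p} → p ↭ a ∷ us → b ∷ c ∷ p ↭ vs
      bc∷ p↭ = ↭-trans (prep b (prep c p↭)) (↭-trans (shift a (b ∷ c ∷ []) us) (↭-sym vs↭))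

      module _ {m : List X} (bc∈ : e b c ∈ m)
               (join : ∀ {u} → u ∈ us → e u b ∈ m ⊎ e u c ∈ m) where

        flip : ∀ {u v} → e u v ∈ m → e v u ∈ m
        flip = subst (_∈ m) (e-comm _ _)

        extend : ∀ p → p ↭ a ∷ us → Linked (λ u v → e u v ∈ m) p → HasPath e vs m
        extend []      p↭ _ with () ← ↭-length p↭
        extend (x ∷ q) p↭ linked with ∈-resp-↭ p↭ (here refl)
        ... | there x∈us with join x∈us
        ...   | inj₁ xb∈ = c ∷ b ∷ x ∷ q , ↭-trans (swap c b refl) (bc∷ p↭) ,
                           flip bc∈ ∷ flip xb∈ ∷ linked
        ...   | inj₂ xc∈ = b ∷ c ∷ x ∷ q , bc∷ p↭ , bc∈ ∷ flip xc∈ ∷ linked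
        -- The path starts at `a`, from which no edge to `b` or `c` is guaranteed. Its last vertex
        -- `z` lies in `us`, so the path is extended there instead.
        extend (_ ∷ q) p↭ linked | here refl with initLast q
        ...   | [] = contradiction (subst (3 ≤_) (sym (↭-length (drop-∷ p↭))) len≥3) λ ()
        ...   | q′ ∷ʳ′ z = path (join (∈-resp-↭ (drop-∷ p↭) (∈-++⁺ʳ q′ (here refl))))
          where
          append : ∀ d d′ → (a ∷ q′) ++ z ∷ d ∷ d′ ∷ [] ↭ d ∷ d′ ∷ (a ∷ q′) ∷ʳ z
          append d d′ = subst (_↭ d ∷ d′ ∷ (a ∷ q′) ∷ʳ z) (++-assoc (a ∷ q′) [ z ] (d ∷ d′ ∷ []))
                              (++-comm ((a ∷ q′) ∷ʳ z) (d ∷ d′ ∷ []))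
          path : e z b ∈ m ⊎ e z c ∈ m → HasPath e vs m
          path (inj₁ zb∈) = _ , ↭-trans (append b c) (bc∷ p↭) ,
                            Linked-∷ʳ (a ∷ q′) linked (zb∈ ∷ bc∈ ∷ [-])
          path (inj₂ zc∈) = _ , ↭-trans (append c b) (↭-trans (swap c b refl) (bc∷ p↭)) ,
                            Linked-∷ʳ (a ∷ q′) linked (zc∈ ∷ flip bc∈ ∷ [-])

      goal : ∀ {m₁ m₂ m} → m₁ ⊆ m → m₂ ⊆ m → HasPath e (a ∷ us) m₁ →
             [ e b c ] ⊆ m₂ × HitsPairs (map joinTo us) m₂ → HasPath e vs m
      goal m₁⊆ m₂⊆ (p , p↭ , linked) (bc∈ , hits) =
        extend (m₂⊆ (bc∈ (here refl)))
          (λ u∈ → Sum.map m₂⊆ m₂⊆ (All.lookup hits (∈-map⁺ joinTo u∈)))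
          p p↭ (Linked.map m₁⊆ linked)

  -- Each step removes the two vertices `b` and `c`, hence the two base cases of five and six
  -- vertices.
  winsPath : ∀ k {vs} → Unique vs → length vs ≡ 5 + k → WinsPath vs
  winsPath 0 unique len = winsPath-greedy 4 2 (m≤m+n 2 3) greedy₅ unique len
  winsPath 1 unique len = winsPath-greedy 6 3 (m≤m+n 3 2) greedy₆ unique len
  winsPath (suc (suc k)) {vs} unique len =
    opening unique (subst (3 ≤_) (sym len) (m≤m+n 3 _)) reply
    where
    reply : ∀ {a b c us} → vs ↭ a ∷ b ∷ c ∷ us → Answered vs a b c us
    reply {us = us} vs↭ = pairingReply unique′ (subst (3 ≤_) (sym len-us) (m≤m+n 3 _))
                                  (winsPath k (unique-a∷us unique′) (cong suc len-us)) vs↭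
      where
      unique′ = Unique-resp-↭ vs↭ unique
      len-us : length us ≡ 4 + k
      len-us = suc-injective (suc-injective (suc-injective (trans (sym (↭-length vs↭)) len)))

-- The game HP n

module _ {n : ℕ} where

  -- The value at u ≡ v is junk.
  between : Fin (2 + n) → Fin (2 + n) → Edge (2 + n)
  between u v with Finₚ.<-cmp u v
  ... | tri< u<v _ _ = edge u v u<v
  ... | tri≈ _ _ _   = edge zero (suc zero) z<s
  ... | tri> _ _ v<u = edge v u v<u

  Joins-between : ∀ {u v} → u ≢ v → Joins (between u v) u v
  Joins-between {u} {v} u≢v with Finₚ.<-cmp u v
  ... | tri< _ _ _   = inj₁ (refl , refl)
  ... | tri≈ _ u≡v _ = contradiction u≡v u≢v
  ... | tri> _ _ _   = inj₂ (refl , refl)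

  Joins⇒≡between : ∀ {ε u v} → Joins ε u v → ε ≡ between u v
  Joins⇒≡between {edge u v u<v} (inj₁ (refl , refl)) with Finₚ.<-cmp u v
  ... | tri< _ _ _    = refl
  ... | tri≈ u≮v _ _  = contradiction-irr u<v u≮v
  ... | tri> u≮v _ _  = contradiction-irr u<v u≮v
  Joins⇒≡between {edge v u v<u} (inj₂ (refl , refl)) with Finₚ.<-cmp u v
  ... | tri< _ _ v≮u  = contradiction-irr v<u v≮u
  ... | tri≈ _ _ v≮u  = contradiction-irr v<u v≮u
  ... | tri> _ _ _    = refl

  between-comm : ∀ u v → between u v ≡ between v u
  between-comm u v with u Finₚ.≟ v
  ... | yes refl = refl
  ... | no  u≢v  = Joins⇒≡between (Sum.swap (Joins-between u≢v))

  Joins-functional : ∀ {ε : Edge (2 + n)} {u v u′ v′} → Joins ε u v → Joins ε u′ v′ →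
                     (u ≡ u′ × v ≡ v′) ⊎ (u ≡ v′ × v ≡ u′)
  Joins-functional (inj₁ (refl , refl)) (inj₁ eqs)           = inj₁ eqs
  Joins-functional (inj₁ (refl , refl)) (inj₂ eqs)           = inj₂ eqs
  Joins-functional (inj₂ (refl , refl)) (inj₁ (lo≡ , hi≡)) = inj₂ (hi≡ , lo≡)
  Joins-functional (inj₂ (refl , refl)) (inj₂ (lo≡ , hi≡)) = inj₁ (hi≡ , lo≡)

  between-injective : ∀ {u v u′ v′} → u ≢ v → u′ ≢ v′ → between u v ≡ between u′ v′ →
                      (u ≡ u′ × v ≡ v′) ⊎ (u ≡ v′ × v ≡ u′)
  between-injective {u} {v} {u′} {v′} u≢v u′≢v′ eq =
    Joins-functional {between u v} (Joins-between u≢v)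
      (subst (λ ε → Joins ε u′ v′) (sym eq) (Joins-between u′≢v′))

  OnPath⇒∈ : ∀ {p m ε} → Linked (λ u v → between u v ∈ m) p → OnPath p ε → ε ∈ m
  OnPath⇒∈ (uv∈m ∷ _)   (here joins)   = subst (_∈ _) (sym (Joins⇒≡between joins)) uv∈m
  OnPath⇒∈ (_ ∷ linked) (there onPath) = OnPath⇒∈ linked onPath
  OnPath⇒∈ [-] (there ())

  hamiltonianPath : ∀ {p} → p ↭ allFin (2 + n) → HamiltonianPath (2 + n)
  hamiltonianPath {p} p↭ = record
    { vertices = p
    ; simple   = Unique-resp-↭ (↭-sym p↭) (allFin⁺ _)
    ; spanning = λ v → ∈-resp-↭ (↭-sym p↭) (∈-allFin v)
    }

-- Maker's win on at least five vertices

-- The regional strategy is one for moving second. If Maker moves first, `follow` spends the opening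
-- move on an arbitrary edge, so both orders are covered at once.
makerWins : ∀ k first → MakerBreaker.HasWinningStrategy (HP (5 + k)) first maker
makerWins k first = follow maker (_ , _ , w) , wins
  where
  open Play (HP (5 + k)) first
  open MakerBreaker (HP (5 + k)) first using (Reachable; Complete; Won)
  open Graph between between-comm between-injective
  w = proj₂ (proj₂ (winsPath k (allFin⁺ (5 + k)) (length-tabulate {n = 5 + k} id)))
  wins : ∀ h → Reachable maker (follow maker (_ , _ , w)) h → Complete h → Won maker h
  wins h r complete with m , (p , p↭ , linked) , m⊆ ← follow-wins maker w r complete =
    edgeSet P , (P , id , id) , λ onPath → m⊆ (OnPath⇒∈ linked onPath)
    where P = hamiltonianPath p↭

-- Breaker's win on four vertices

matchings : List (Edge 4 × Edge 4)
matchings =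
    (between zero (suc zero)             , between (suc (suc zero)) (suc (suc (suc zero))))
  ∷ (between zero (suc (suc zero))       , between (suc zero) (suc (suc (suc zero))))
  ∷ (between zero (suc (suc (suc zero))) , between (suc zero) (suc (suc zero)))
  ∷ []

IsPair : {A : Set} → A × A → A → A → Set
IsPair (x , x′) y y′ = (x ≡ y × x′ ≡ y′) ⊎ (x ≡ y′ × x′ ≡ y)

abstract
  -- Checked by deciding the claim for all quadruples of vertices; `abstract` keeps the decision
  -- from being unfolded later.
  endEdges-matching : ∀ (a b c d : Fin 4) → Unique (a ∷ b ∷ c ∷ d ∷ []) →
    Any (λ matching → IsPair matching (between a b) (between c d)) matchings
  endEdges-matching = from-yes (all? λ a → all? λ b → all? λ c → all? λ d →
    unique? (a ∷ b ∷ c ∷ d ∷ []) →-dec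
    any? (λ matching → isPair? matching (between a b) (between c d)) matchings)
    where
    open DecUnique Finₚ._≟_ using (unique?)
    isPair? : ∀ matching (ε ε′ : Edge 4) → Dec (IsPair matching ε ε′)
    isPair? (x , x′) y y′ = (x ≟ᴱ y ×-dec x′ ≟ᴱ y′) ⊎-dec (x ≟ᴱ y′ ×-dec x′ ≟ᴱ y)

unique-matchings : Unique (flatten matchings)
unique-matchings = from-yes (unique? (flatten matchings))
  where open DecUnique _≟ᴱ_ using (unique?)

-- The first and last edges of a path on four vertices form a perfect matching, one of whose edges
-- is in `m`.
matching-hits : ∀ (P : HamiltonianPath 4) {m} → HitsPairs matchings m →
                ∃[ ε ] (edgeSet P ε × ε ∈ m)
matching-hits P {m} hits = go vertices simple p↭
  where
  open HamiltonianPath P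
  p↭ : vertices ↭ allFin 4
  p↭ = ∼bag⇒↭ (unique∧set⇒bag simple (allFin⁺ 4)
                (mk⇔ (λ _ → ∈-allFin _) (λ _ → spanning _)))

  go : ∀ p → Unique p → p ↭ allFin 4 → ∃[ ε ] (OnPath p ε × ε ∈ m)
  go p unique p↭ with ↭-length p↭
  go (a ∷ b ∷ c ∷ d ∷ []) unique@((a≢b ∷ _) ∷ _ ∷ (c≢d ∷ _) ∷ _) _ | refl
    with (ε , ε′) , matching , ends ← find (endEdges-matching a b c d unique)
    with ends | All.lookup hits matching
  ... | inj₁ (refl , refl) | inj₁ ε∈m  = _ , here (Joins-between a≢b) , ε∈m
  ... | inj₁ (refl , refl) | inj₂ ε′∈m = _ , there (there (here (Joins-between c≢d))) , ε′∈m
  ... | inj₂ (refl , refl) | inj₁ ε∈m  = _ , there (there (here (Joins-between c≢d))) , ε∈m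
  ... | inj₂ (refl , refl) | inj₂ ε′∈m = _ , here (Joins-between a≢b) , ε′∈m

-- A winning strategy of Maker is played out against Breaker's pairing strategy. Some edge of
-- Maker's completed path would then belong to both players.
¬makerWins₄ : ∀ first → ¬ MakerBreaker.HasWinningStrategy (HP 4) first maker
¬makerWins₄ first (σ , wins) =
  let w                      = pairing matchings [] unique-matchings
      τ                      = follow breaker (_ , _ , w)
      h , rσ , rτ , complete = playOut σ τ
      m , (_ , hits) , m⊆    = follow-wins breaker w rτ complete
      F , (P , F≐) , F⊆      = wins h rσ complete
      ε , ε∈P , ε∈m          = matching-hits P hits
  in ¬bothClaimed rσ (F⊆ (proj₂ F≐ ε∈P)) (m⊆ ε∈m)
  where open Play (HP 4) first

makerWins⇔n≥5 : ∀ n → n ≥ 4 → ∀ first →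
                MakerBreaker.HasWinningStrategy (HP n) first maker ⇔ n ≥ 5
makerWins⇔n≥5 4 _ first = mk⇔ (λ wins → contradiction wins (¬makerWins₄ first))
                              λ { (s≤s (s≤s (s≤s (s≤s ())))) }
makerWins⇔n≥5 (suc (suc (suc (suc (suc k))))) _ first =
  mk⇔ (λ _ → s≤s (s≤s (s≤s (s≤s (s≤s z≤n))))) λ _ → makerWins k first
makerWins⇔n≥5 1 (s≤s ()) first
makerWins⇔n≥5 2 (s≤s (s≤s ())) first
makerWins⇔n≥5 3 (s≤s (s≤s (s≤s ()))) first

theorem2 : ∀ (n : ℕ) → n ≥ 4 →
    (MakerWinsAsFirstPlayer (HP n) ⇔ n ≥ 5) ×
    (MakerWinsAsSecondPlayer (HP n) ⇔ n ≥ 5)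
theorem2 n n≥4 = makerWins⇔n≥5 n n≥4 maker , makerWins⇔n≥5 n n≥4 breaker
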